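{- Let $A,B$ be types and $F:(A\to B^\nu)\to(A\to B^\nu)$ be finitary. Then $\mathsf{Y}(F)$ is a fixed point of $F$ up to extensional equality: for all $a:A$, $F\,\mathsf{Y}(F)\,a\approx\mathsf{Y}(F)\,a$.
   Context: Work in an intensional constructive dependent type theory with inductive and coinductive types. For a type $B$, $B^\nu$ is the coinductive type with constructors $\mathsf{return}:B\to B^\nu$ and $\mathsf{step}:B^\nu\to B^\nu$; $\mathsf{step}^\infty=\mathsf{step}\,\mathsf{step}^\infty$ (corecursively). Convergence $x\downarrow b$ is inductive: $\mathsf{return}\,b\downarrow b$; $x\downarrow b\Rightarrow\mathsf{step}\,x\downarrow b$. Equality $x\approx y$ is coinductive: $x\downarrow b\wedge y\downarrow b\Rightarrow x\approx y$; $x\approx y\Rightarrow\mathsf{step}\,x\approx\mathsf{step}\,y$. $F$ is finitary if for every $f:A\to B^\nu$, $a:A$, $b:B$ with $F\,f\,a\downarrow b$, there exist finitely many $a_1,\dots,a_n:A$ and $b_1,\dots,b_n:B$ with $f\,a_i\downarrow b_i$ for all $i$ such that for every $g:A\to B^\nu$, if $g\,a_i\downarrow b_i$ for all $i$ then $F\,g\,a\downarrow b$. $\mathsf{fstconv}:B^\nu\to B^\nu\to B^\nu$ is defined corecursively by $\mathsf{fstconv}\,(\mathsf{return}\,b)\,y=\mathsf{return}\,b$; $\mathsf{fstconv}\,(\mathsf{step}\,x)\,(\mathsf{return}\,b)=\mathsf{return}\,b$; $\mathsf{fstconv}\,(\mathsf{step}\,x)\,(\mathsf{step}\,y)=\mathsf{step}(\mathsf{fstconv}\,x\,y)$.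 $\mathsf{psa}:(\mathbb{N}\to B^\nu)\to\mathbb{N}\to B^\nu\to B^\nu$ is defined corecursively by $\mathsf{psa}\,f\,n\,(\mathsf{return}\,b)=\mathsf{return}\,b$, $\mathsf{psa}\,f\,n\,(\mathsf{step}\,x)=\mathsf{step}(\mathsf{psa}\,f\,(n+1)\,(\mathsf{fstconv}\,x\,(f\,n)))$, and $\mathsf{parallel\_search}\,f=\mathsf{psa}\,f\,0\,\mathsf{step}^\infty$. Let $k_0=\lambda a.\,\mathsf{step}^\infty$ and $k_{n+1}=F\,k_n$. Then $\mathsf{Y}(F)=\lambda a:A.\,\mathsf{parallel\_search}(\lambda n.\,k_n\,a)$. -}

module Defs where

open import Level using (Level; suc; _⊔_)
open import Data.Nat using (ℕ; zero) renaming (suc to 1+)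
open import Data.Maybe using (Maybe; just; nothing)
open import Data.Sum using (_⊎_; inj₁; inj₂)
open import Data.List using (List)
open import Data.List.Relation.Unary.All using (All)
open import Data.Product using (Σ; ∃; _×_; _,_; proj₁; proj₂)
open import Relation.Binary.PropositionalEquality using (_≡_; refl)

-- This workspace forbids --guardedness / --sized-types, so the
-- coinductive type B^ν (constructors return, step) is represented by its
-- standard encoding as a final coalgebra of  X ↦ B ⊎ X :  a "trace"
-- s : ℕ → Maybe B with the invariant that once s is `just b` it stays
-- `just b`.  The element step^k (return b) is the trace that is
-- `nothing` below k and `just b` from k on; step^∞ is the constant
-- `nothing` trace.  This correspondence is a bijection (up to funext).

Stable : ∀ {ℓ} {B : Set ℓ} → (ℕ → Maybe B) → Set ℓ
Stable {B = B} s = (n : ℕ) (b : B) → s n ≡ just b → s (1+ n) ≡ just b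

Delay : ∀ {ℓ} → Set ℓ → Set ℓ
Delay B = Σ (ℕ → Maybe B) Stable

return : ∀ {ℓ} {B : Set ℓ} → B → Delay B
return b = (λ _ → just b) , λ _ _ e → e

step : ∀ {ℓ} {B : Set ℓ} → Delay B → Delay B
step (s , st) = s' , st'
  where
  s' : ℕ → Maybe _
  s' zero = nothing
  s' (1+ n) = s n
  st' : Stable s'
  st' zero b ()
  st' (1+ n) b e = st n b e

out : ∀ {ℓ} {B : Set ℓ} → Delay B → B ⊎ Delay B
out (s , st) with s zero
... | just b  = inj₁ b
... | nothing = inj₂ ((λ n → s (1+ n)) , λ n b e → st (1+ n) b e)

module _ {ℓ ℓ'} {B : Set ℓ} {S : Set ℓ'} (c : S → B ⊎ S) where
  private
    tr : S → ℕ → Maybe B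
    tr σ zero with c σ
    ... | inj₁ b = just b
    ... | inj₂ _ = nothing
    tr σ (1+ n) with c σ
    ... | inj₁ b = just b
    ... | inj₂ σ' = tr σ' n

    trSt : (σ : S) → Stable (tr σ)
    trSt σ zero b e with c σ
    trSt σ zero b e | inj₁ b' = e
    trSt σ zero b () | inj₂ _
    trSt σ (1+ n) b e with c σ
    ... | inj₁ b' = e
    ... | inj₂ σ' = trSt σ' n b e

  unfold : S → Delay B
  unfold σ = tr σ , trSt σ

step∞ : ∀ {ℓ} {B : Set ℓ} → Delay B
step∞ = (λ _ → nothing) , λ _ _ ()

data _↓_ {ℓ} {B : Set ℓ} (x : Delay B) (b : B) : Set ℓ where
  now   : out x ≡ inj₁ b → x ↓ b
  later : ∀ {x'} → out x ≡ inj₂ x' → x' ↓ b → x ↓ b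

-- equality x ≈ y (coinductive), as the greatest fixed point: x ≈ y iff
-- (x , y) lies in some post-fixed point (bisimulation) of the rules
--   x ↓ b ∧ y ↓ b ⇒ x ≈ y ;   x ≈ y ⇒ step x ≈ step y
IsBisim : ∀ {ℓ} {B : Set ℓ} → (Delay B → Delay B → Set ℓ) → Set ℓ
IsBisim {B = B} R = ∀ x y → R x y →
  (Σ B λ b → x ↓ b × y ↓ b) ⊎
  (Σ (Delay B) λ x' → Σ (Delay B) λ y' →
     out x ≡ inj₂ x' × out y ≡ inj₂ y' × R x' y')

_≈_ : ∀ {ℓ} {B : Set ℓ} → Delay B → Delay B → Set (suc ℓ)
_≈_ {ℓ} {B} x y = Σ (Delay B → Delay B → Set ℓ) λ R → IsBisim R × R x y

Finitary : ∀ {ℓ} {A B : Set ℓ} → ((A → Delay B) → (A → Delay B)) → Set ℓ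
Finitary {A = A} {B} F =
  (f : A → Delay B) (a : A) (b : B) → F f a ↓ b →
  Σ (List (A × B)) λ ps →
    All (λ p → f (proj₁ p) ↓ proj₂ p) ps ×
    ((g : A → Delay B) → All (λ p → g (proj₁ p) ↓ proj₂ p) ps → F g a ↓ b)

-- fstconv (corecursive, state = pair of computations)
--   fstconv (return b) y          = return b
--   fstconv (step x) (return b)   = return b
--   fstconv (step x) (step y)     = step (fstconv x y)
fstconv : ∀ {ℓ} {B : Set ℓ} → Delay B → Delay B → Delay B
fstconv x y = unfold c (x , y)
  where
  c : _ → _
  c (x , y) with out x
  ... | inj₁ b = inj₁ b
  ... | inj₂ x' with out y
  ...   | inj₁ b = inj₁ b
  ...   | inj₂ y' = inj₂ (x' , y')

-- psa (corecursive, state = (n , x))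
--   psa f n (return b) = return b
--   psa f n (step x)   = step (psa f (n+1) (fstconv x (f n)))
psa : ∀ {ℓ} {B : Set ℓ} → (ℕ → Delay B) → ℕ → Delay B → Delay B
psa f n x = unfold c (n , x)
  where
  c : _ → _
  c (n , x) with out x
  ... | inj₁ b = inj₁ b
  ... | inj₂ x' = inj₂ (1+ n , fstconv x' (f n))

parallel-search : ∀ {ℓ} {B : Set ℓ} → (ℕ → Delay B) → Delay B
parallel-search f = psa f 0 step∞

kiter : ∀ {ℓ} {A B : Set ℓ} → ((A → Delay B) → (A → Delay B)) → ℕ → A → Delay B
kiter F zero = λ a → step∞
kiter F (1+ n) = F (kiter F n)

Y : ∀ {ℓ} {A B : Set ℓ} → ((A → Delay B) → (A → Delay B)) → A → Delay B
Y F a = parallel-search (λ n → kiter F n a)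

-- Finitarity makes F monotone, so the Kleene iterates k₀ ⊑ k₁ ⊑ … form a
-- chain, and parallel search along a chain converges to b exactly when some
-- kₙ does: whichever stage wins the race, its value agrees with b at a later
-- common stage, since convergence is deterministic.  Hence Y F a ↓ b iff
-- ∃ n, kₙ a ↓ b.  Now F (Y F) a ↓ b uses only finitely many convergences of
-- Y F, all already present in one stage k_N, so k_{N+1} a ↓ b; conversely
-- k_{n+1} a = F kₙ a and kₙ ⊑ Y F.  Computations with the same limits are
-- bisimilar, which gives F (Y F) a ≈ Y F a.
module Submission where

open import Defs
open import Data.Nat using (ℕ; zero; _+_; _≤_; _≤′_; ≤′-refl; ≤′-step) renaming (suc to 1+)
open import Data.Nat.Properties using (+-suc; +-identityʳ; ≤⇒≤′; m≤m+n; m≤n+m)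
open import Data.Maybe using (Maybe; just; nothing)
open import Data.Maybe.Properties using (just-injective)
open import Data.Sum as Sum using (_⊎_; inj₁; inj₂)
open import Data.Sum.Properties using (inj₁-injective; inj₂-injective)
open import Data.List using (List; []; _∷_)
open import Data.List.Relation.Unary.All using (All; []; _∷_) renaming (map to All-map)
open import Data.Product using (∃; _×_; _,_; proj₁; proj₂)
open import Data.Empty using (⊥-elim)
open import Function.Bundles using (_⇔_; mk⇔; module Equivalence)
open import Relation.Nullary using (¬_)
open import Relation.Binary.PropositionalEquality using (_≡_; _≢_; refl; sym; trans; cong; subst)

open Equivalence using (to; from)

propagate-≤ : ∀ {p} {P : ℕ → Set p} → (∀ n → P n → P (1+ n)) →
              ∀ {m n} → m ≤ n → P m → P n
propagate-≤ {P = P} next m≤n = go (≤⇒≤′ m≤n)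
  where
  go : ∀ {m n} → m ≤′ n → P m → P n
  go ≤′-refl       p = p
  go (≤′-step m≤n) p = next _ (go m≤n p)

nothing≢just : ∀ {ℓ} {B : Set ℓ} {b : B} → nothing ≢ just b
nothing≢just ()

module _ {ℓ} {B : Set ℓ} where

  ↓-later⁻ : ∀ {x x' : Delay B} {b} → out x ≡ inj₂ x' → x ↓ b → x' ↓ b
  ↓-later⁻ e (now e')       with () ← trans (sym e) e'
  ↓-later⁻ e (later e' x'↓) with refl ← inj₂-injective (trans (sym e) e') = x'↓

  ↓-deterministic : ∀ {x : Delay B} {b c} → x ↓ b → x ↓ c → b ≡ c
  ↓-deterministic (now e)      (now e')     = inj₁-injective (trans (sym e) e')
  ↓-deterministic (now e)      (later e' _) with () ← trans (sym e) e'
  ↓-deterministic (later e x↓) x↓c          = ↓-deterministic x↓ (↓-later⁻ e x↓c)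

  SameLimits : Delay B → Delay B → Set ℓ
  SameLimits x y = ∀ b → x ↓ b ⇔ y ↓ b

  SameLimits-isBisim : IsBisim SameLimits
  SameLimits-isBisim x y same with out x in ex | out y in ey
  ... | inj₁ b  | _       = inj₁ (b , now ex , to (same b) (now ex))
  ... | inj₂ _  | inj₁ b  = inj₁ (b , from (same b) (now ey) , now ey)
  ... | inj₂ x' | inj₂ y' = inj₂ (x' , y' , refl , refl , λ b → mk⇔
        (λ x'↓ → ↓-later⁻ ey (to (same b) (later ex x'↓)))
        (λ y'↓ → ↓-later⁻ ex (from (same b) (later ey y'↓))))

  SameLimits⇒≈ : ∀ {x y} → SameLimits x y → x ≈ y
  SameLimits⇒≈ same = SameLimits , SameLimits-isBisim , same

  -- fstconv and psa only compute once the head of a trace is known, so they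
  -- are analysed through convergence at an explicit trace index.

  trace : Delay B → ℕ → Maybe B
  trace = proj₁

  tail : Delay B → Delay B
  tail (s , st) = (λ n → s (1+ n)) , λ n b e → st (1+ n) b e

  _⇓_ : Delay B → B → Set ℓ
  x ⇓ b = ∃ λ n → trace x n ≡ just b

  ⇓-tail⁻ : (x : Delay B) {b : B} → tail x ⇓ b → x ⇓ b
  ⇓-tail⁻ x (n , h) = 1+ n , h

  trace-constant : (x : Delay B) {b : B} → trace x 0 ≡ just b → ∀ n → trace x n ≡ just b
  trace-constant x e zero   = e
  trace-constant x e (1+ n) = proj₂ x n _ (trace-constant x e n)

  trace-head : (x : Delay B) (n : ℕ) {b c : B} → trace x 0 ≡ just c → trace x n ≡ just b → c ≡ b
  trace-head x n e h = just-injective (trans (sym (trace-constant x e n)) h)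

  out-now : (x : Delay B) {b : B} → trace x 0 ≡ just b → out x ≡ inj₁ b
  out-now (s , _) e rewrite e = refl

  out-later : (x : Delay B) → trace x 0 ≡ nothing → out x ≡ inj₂ (tail x)
  out-later (s , _) e rewrite e = refl

  out-now⁻ : (x : Delay B) {b : B} → out x ≡ inj₁ b → trace x 0 ≡ just b
  out-now⁻ (s , _) e with s zero
  out-now⁻ (s , _) refl | just _ = refl

  out-later⁻ : (x : Delay B) {x' : Delay B} → out x ≡ inj₂ x' → ∀ n → trace x' n ≡ trace x (1+ n)
  out-later⁻ (s , _) e n with s zero
  out-later⁻ (s , _) refl n | nothing = refl

  ↓⇒⇓ : (x : Delay B) {b : B} → x ↓ b → x ⇓ b
  ↓⇒⇓ x (now e) = 0 , out-now⁻ x e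
  ↓⇒⇓ x (later {x'} e x'↓) with n , h ← ↓⇒⇓ x' x'↓ = 1+ n , trans (sym (out-later⁻ x e n)) h

  ⇓⇒↓ : (x : Delay B) {b : B} → x ⇓ b → x ↓ b
  ⇓⇒↓ x (n , h) = go n x h
    where
    go : ∀ {b} n (x : Delay B) → trace x n ≡ just b → x ↓ b
    go n x h with trace x 0 in e
    ... | just c = subst (x ↓_) (trace-head x n e h) (now (out-now x e))
    go zero   x h | nothing = ⊥-elim (nothing≢just (trans (sym e) h))
    go (1+ n) x h | nothing = later (out-later x e) (go n (tail x) h)

  step∞-diverges : ∀ {b} → ¬ (step∞ ↓ b)
  step∞-diverges step∞↓ with ↓⇒⇓ step∞ step∞↓
  ... | _ , ()

  fstconv-left : (x y : Delay B) {b : B} → trace x 0 ≡ just b → trace (fstconv x y) 0 ≡ just b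
  fstconv-left (s , _) _ e rewrite e = refl

  fstconv-right : (x y : Delay B) {b : B} → trace x 0 ≡ nothing → trace y 0 ≡ just b →
                  trace (fstconv x y) 0 ≡ just b
  fstconv-right (s , _) (t , _) e₁ e₂ rewrite e₁ | e₂ = refl

  fstconv-later₀ : (x y : Delay B) → trace x 0 ≡ nothing → trace y 0 ≡ nothing →
                   trace (fstconv x y) 0 ≡ nothing
  fstconv-later₀ (s , _) (t , _) e₁ e₂ rewrite e₁ | e₂ = refl

  fstconv-later : (x y : Delay B) → trace x 0 ≡ nothing → trace y 0 ≡ nothing →
                  ∀ n → trace (fstconv x y) (1+ n) ≡ trace (fstconv (tail x) (tail y)) n
  fstconv-later (s , _) (t , _) e₁ e₂ n rewrite e₁ | e₂ = refl

  fstconv-⇓⁻ : (n : ℕ) (x y : Delay B) {b : B} → trace (fstconv x y) n ≡ just b → x ⇓ b ⊎ y ⇓ b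
  fstconv-⇓⁻ n x y h with trace x 0 in e₁ | trace y 0 in e₂
  ... | just _  | _      = inj₁ (0 , trans e₁ (cong just (trace-head (fstconv x y) n (fstconv-left x y e₁) h)))
  ... | nothing | just _ = inj₂ (0 , trans e₂ (cong just (trace-head (fstconv x y) n (fstconv-right x y e₁ e₂) h)))
  fstconv-⇓⁻ zero   x y h | nothing | nothing =
    ⊥-elim (nothing≢just (trans (sym (fstconv-later₀ x y e₁ e₂)) h))
  fstconv-⇓⁻ (1+ n) x y h | nothing | nothing =
    Sum.map (⇓-tail⁻ x) (⇓-tail⁻ y)
      (fstconv-⇓⁻ n (tail x) (tail y) (trans (sym (fstconv-later x y e₁ e₂ n)) h))

  fstconv-⇓⁺ : (x y : Delay B) (n : ℕ) {b : B} → trace x n ≡ just b ⊎ trace y n ≡ just b →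
               ∃ λ c → trace (fstconv x y) n ≡ just c
  fstconv-⇓⁺ x y n h with trace x 0 in e₁ | trace y 0 in e₂
  ... | just c  | _      = c , trace-constant (fstconv x y) (fstconv-left x y e₁) n
  ... | nothing | just c = c , trace-constant (fstconv x y) (fstconv-right x y e₁ e₂) n
  fstconv-⇓⁺ x y zero (inj₁ h) | nothing | nothing = ⊥-elim (nothing≢just (trans (sym e₁) h))
  fstconv-⇓⁺ x y zero (inj₂ h) | nothing | nothing = ⊥-elim (nothing≢just (trans (sym e₂) h))
  fstconv-⇓⁺ x y (1+ n) h | nothing | nothing
    with c , h' ← fstconv-⇓⁺ (tail x) (tail y) n h = c , trans (fstconv-later x y e₁ e₂ n) h'

  module _ (f : ℕ → Delay B) where

    psa-now : (n : ℕ) (x : Delay B) {b : B} → trace x 0 ≡ just b → trace (psa f n x) 0 ≡ just b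
    psa-now n (s , _) e rewrite e = refl

    psa-later₀ : (n : ℕ) (x : Delay B) → trace x 0 ≡ nothing → trace (psa f n x) 0 ≡ nothing
    psa-later₀ n (s , _) e rewrite e = refl

    psa-later : (n : ℕ) (x : Delay B) → trace x 0 ≡ nothing →
                ∀ k → trace (psa f n x) (1+ k) ≡ trace (psa f (1+ n) (fstconv (tail x) (f n))) k
    psa-later n (s , _) e k rewrite e = refl

    psa-later-⇓ : (n : ℕ) (x : Delay B) {b : B} → trace x 0 ≡ nothing →
                  psa f (1+ n) (fstconv (tail x) (f n)) ⇓ b → psa f n x ⇓ b
    psa-later-⇓ n x e (k , h) = 1+ k , trans (psa-later n x e k) h

    psa-⇓⁻ : (k n : ℕ) (x : Delay B) {b : B} → trace (psa f n x) k ≡ just b → x ⇓ b ⊎ ∃ λ j → f j ⇓ b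
    psa-⇓⁻ k n x h with trace x 0 in e
    ... | just _ = inj₁ (0 , trans e (cong just (trace-head (psa f n x) k (psa-now n x e) h)))
    psa-⇓⁻ zero   n x h | nothing = ⊥-elim (nothing≢just (trans (sym (psa-later₀ n x e)) h))
    psa-⇓⁻ (1+ k) n x h | nothing
      with psa-⇓⁻ k (1+ n) (fstconv (tail x) (f n)) (trans (sym (psa-later n x e k)) h)
    ... | inj₂ found       = inj₂ found
    ... | inj₁ (m , race⇓) = Sum.map (⇓-tail⁻ x) (n ,_) (fstconv-⇓⁻ m (tail x) (f n) race⇓)

    psa-⇓⁺-current : (m n : ℕ) (x : Delay B) {b : B} → trace x m ≡ just b → ∃ λ c → psa f n x ⇓ c
    psa-⇓⁺-current m n x h with trace x 0 in e
    ... | just c = c , 0 , psa-now n x e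
    psa-⇓⁺-current zero   n x h | nothing = ⊥-elim (nothing≢just (trans (sym e) h))
    psa-⇓⁺-current (1+ m) n x h | nothing =
      let _ , race⇓ = fstconv-⇓⁺ (tail x) (f n) m (inj₁ h)
          c , psa⇓  = psa-⇓⁺-current m (1+ n) (fstconv (tail x) (f n)) race⇓
      in  c , psa-later-⇓ n x e psa⇓

    psa-⇓⁺-pending : (j n : ℕ) (x : Delay B) {b : B} → f (j + n) ⇓ b → ∃ λ c → psa f n x ⇓ c
    psa-⇓⁺-pending j n x f⇓ with trace x 0 in e
    ... | just c = c , 0 , psa-now n x e
    psa-⇓⁺-pending zero n x (m , h) | nothing =
      let _ , race⇓ = fstconv-⇓⁺ (tail x) (f n) m (inj₂ h)
          c , psa⇓  = psa-⇓⁺-current m (1+ n) (fstconv (tail x) (f n)) race⇓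
      in  c , psa-later-⇓ n x e psa⇓
    psa-⇓⁺-pending (1+ j) n x {b} f⇓ | nothing =
      let c , psa⇓ = psa-⇓⁺-pending j (1+ n) (fstconv (tail x) (f n)) (subst (λ i → f i ⇓ b) (sym (+-suc j n)) f⇓)
      in  c , psa-later-⇓ n x e psa⇓

    parallel-search-sound : ∀ {b} → parallel-search f ↓ b → ∃ λ j → f j ↓ b
    parallel-search-sound search↓ with k , h ← ↓⇒⇓ _ search↓ with psa-⇓⁻ k 0 step∞ h
    ... | inj₂ (j , f⇓) = j , ⇓⇒↓ (f j) f⇓

    parallel-search-terminates : ∀ j {b} → f j ↓ b → ∃ λ c → parallel-search f ↓ c
    parallel-search-terminates j f↓ =
      let c , search⇓ = psa-⇓⁺-pending j 0 step∞ (subst (λ i → f i ⇓ _) (sym (+-identityʳ j)) (↓⇒⇓ (f j) f↓))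
      in  c , ⇓⇒↓ _ search⇓

    parallel-search-chain : (∀ n {b} → f n ↓ b → f (1+ n) ↓ b) →
                            ∀ {b} → parallel-search f ↓ b ⇔ ∃ λ n → f n ↓ b
    parallel-search-chain increasing {b} = mk⇔ parallel-search-sound complete
      where
      mono : ∀ {m n c} → m ≤ n → f m ↓ c → f n ↓ c
      mono = propagate-≤ (λ i → increasing i)

      complete : (∃ λ n → f n ↓ b) → parallel-search f ↓ b
      complete (n , fn↓b) =
        let c , search↓c = parallel-search-terminates n fn↓b
            j , fj↓c     = parallel-search-sound search↓c
        in  subst (parallel-search f ↓_)
                  (↓-deterministic (mono (m≤n+m j n) fj↓c) (mono (m≤m+n n j) fn↓b))
                  search↓c

module _ {ℓ} {A B : Set ℓ} where

  _⊑_ : (A → Delay B) → (A → Delay B) → Set ℓ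
  f ⊑ g = ∀ a {b} → f a ↓ b → g a ↓ b

  Increasing : (ℕ → A → Delay B) → Set ℓ
  Increasing k = ∀ n → k n ⊑ k (1+ n)

  increasing-mono : ∀ {k} → Increasing k → ∀ {m n} → m ≤ n → k m ⊑ k n
  increasing-mono increasing m≤n a = propagate-≤ (λ i → increasing i a) m≤n

  All-eventually : ∀ {k} → Increasing k → (ps : List (A × B)) →
                   All (λ p → ∃ λ n → k n (proj₁ p) ↓ proj₂ p) ps →
                   ∃ λ N → All (λ p → k N (proj₁ p) ↓ proj₂ p) ps
  All-eventually increasing []       []               = 0 , []
  All-eventually increasing (_ ∷ ps) ((n , k↓) ∷ k↓s) =
    let N , kN↓s = All-eventually increasing ps k↓s
    in  n + N , increasing-mono increasing (m≤m+n n N) _ k↓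
              ∷ All-map (λ {p} → increasing-mono increasing (m≤n+m N n) (proj₁ p)) kN↓s

  finitary⇒monotone : ∀ {F f g} → Finitary F → f ⊑ g → F f ⊑ F g
  finitary⇒monotone {f = f} {g} finitary f⊑g a {b} Ff↓ =
    let ps , f↓s , use = finitary f a b Ff↓
    in  use g (All-map (λ {p} → f⊑g (proj₁ p)) f↓s)

  module _ (F : (A → Delay B) → (A → Delay B)) (finitary : Finitary F) where

    kiter-increasing : Increasing (kiter F)
    kiter-increasing zero   _ step∞↓ = ⊥-elim (step∞-diverges step∞↓)
    kiter-increasing (1+ n) = finitary⇒monotone finitary (kiter-increasing n)

    Y-↓ : ∀ a {b} → Y F a ↓ b ⇔ ∃ λ n → kiter F n a ↓ b
    Y-↓ a = parallel-search-chain (λ n → kiter F n a) (λ n → kiter-increasing n a)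

    kiter⊑Y : ∀ n → kiter F n ⊑ Y F
    kiter⊑Y n a kn↓ = from (Y-↓ a) (n , kn↓)

    F-Y⊑Y : F (Y F) ⊑ Y F
    F-Y⊑Y a {b} FY↓ =
      let ps , Y↓s , use = finitary (Y F) a b FY↓
          N , kN↓s       = All-eventually kiter-increasing ps (All-map (λ {p} → to (Y-↓ (proj₁ p))) Y↓s)
      in  kiter⊑Y (1+ N) a (use (kiter F N) kN↓s)

    Y⊑F-Y : Y F ⊑ F (Y F)
    Y⊑F-Y a Y↓ with to (Y-↓ a) Y↓
    ... | zero , step∞↓ = ⊥-elim (step∞-diverges step∞↓)
    ... | 1+ n , Fkn↓   = finitary⇒monotone finitary (kiter⊑Y n) a Fkn↓

theorem6p19 : ∀ {ℓ} {A B : Set ℓ} (F : (A → Delay B) → (A → Delay B)) →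
    Finitary F → (a : A) → F (Y F) a ≈ Y F a
theorem6p19 F finitary a =
  SameLimits⇒≈ λ b → mk⇔ (F-Y⊑Y F finitary a) (Y⊑F-Y F finitary a)
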